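{- Let $Z_1$ and $Z_2$ be finite binary strings. If $EM(Z_1) = EM(Z_2)$ (as infinite binary sequences), then $Z_1 = Z_2$.
   Context: All strings are over the alphabet $\{0,1\}$; for a digit $y$, $y' = 1-y$. Definition of $EM(Z)$ for a finite binary string $Z$ (the seed, possibly empty): it is the infinite binary sequence $x_1x_2x_3\dots$ generated digit by digit as follows. Suppose $x_1,\dots,x_k$ ($k\ge 0$) have been generated and let $W = Zx_1\cdots x_k$ (concatenation). If $W$ is empty (i.e. $Z$ is empty and $k=0$), put $x_1 = 0$. Otherwise let $\sigma$ be the longest tail (suffix, possibly empty) of $W$ that also occurs as a substring of $W$ with its last digit removed. Take the latest (rightmost) such earlier occurrence and let $y$ be the digit of $W$ immediately following it; if $\sigma$ is empty, the latest previous occurrence is understood to be just before the last digit of $W$, so $y$ is the last digit of $W$. Then $x_{k+1} = y'$. The sequence $EM(Z)$ does not include the seed $Z$. -}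

module Defs where

open import Data.Bool.Base using (Bool; true; false; not)
open import Data.Bool.Properties using (_≟_)
open import Data.List.Base using (List; []; _∷_; _++_; _∷ʳ_; length; initLast; _∷ʳ′_; applyUpTo)
open import Data.List.Relation.Binary.Infix.Heterogeneous using (Infix; here; there)
open import Data.List.Relation.Binary.Infix.Heterogeneous.Properties using (infix?)
open import Data.List.Relation.Binary.Pointwise as Pointwise using ()
open import Data.List.Relation.Binary.Prefix.Heterogeneous using (Prefix; []; _∷_)
open import Data.List.Relation.Binary.Suffix.Heterogeneous using (Suffix; here; there)
open import Data.List.Relation.Binary.Suffix.Heterogeneous.Properties using (length-mono)
open import Data.Nat.Base using (ℕ; zero; suc; _≤_; z≤n; s≤s)
open import Data.Product.Base using (∃; _×_; _,_; proj₁)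
open import Relation.Binary.PropositionalEquality using (_≡_; refl; subst)
open import Relation.Nullary using (Dec; yes; no; contradiction)

-- The digit 0 is false and 1 is true, so that y′ = 1 - y is not y.
Digit : Set
Digit = Bool

Str : Set
Str = List Digit

_isSuffixOf_ _isSubstringOf_ _isPrefixOf_ : Str → Str → Set
_isSuffixOf_    = Suffix _≡_
_isSubstringOf_ = Infix _≡_
_isPrefixOf_    = Prefix _≡_

-- An occurrence of σ in V is given by the string α that precedes it, so
-- length α is its position.
OccursAfter : Str → Str → Str → Set
OccursAfter α σ V = (α ++ σ) isPrefixOf V

-- The match for the nonempty string W = V ∷ʳ l: here V is W with its last
-- digit removed, and y is the digit of W following the chosen occurrence.
-- For σ = [] the latest occurrence in V has α = V, hence y = l, which is the
-- convention for an empty σ.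
record Match (V : Str) (l y : Digit) : Set where
  field
    σ α       : Str
    suffix    : σ isSuffixOf (V ∷ʳ l)
    substring : σ isSubstringOf V
    longest   : ∀ τ → τ isSuffixOf (V ∷ʳ l) → τ isSubstringOf V →
                length τ ≤ length σ
    occurs    : OccursAfter α σ V
    latest    : ∀ α′ → OccursAfter α′ σ V → length α′ ≤ length α
    follows   : ((α ++ σ) ∷ʳ y) isPrefixOf (V ∷ʳ l)

data Next : Str → Digit → Set where
  start : Next [] false
  step  : ∀ {V l y} → Match V l y → Next (V ∷ʳ l) (not y)

private
  longestSuffix : ∀ {P : Str → Set} → (∀ s → Dec (P s)) → P [] → ∀ W →
                  ∃ λ σ → σ isSuffixOf W × P σ ×
                          (∀ τ → τ isSuffixOf W → P τ → length τ ≤ length σ)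
  longestSuffix P? p[] [] = [] , here Pointwise.[] , p[] , λ _ τ≤ _ → length-mono τ≤
  longestSuffix {P} P? p[] (w ∷ W) with P? (w ∷ W)
  ... | yes p = w ∷ W , here (Pointwise.refl refl) , p , λ _ τ≤ _ → length-mono τ≤
  ... | no ¬p with longestSuffix P? p[] W
  ...   | σ , suf , p , max = σ , there suf , p , λ where
            τ (here eq) q → contradiction (subst P (Pointwise.Pointwise-≡⇒≡ eq) q) ¬p
            τ (there s) q → max τ s q

  occurs⇒substring : ∀ α {σ V} → OccursAfter α σ V → σ isSubstringOf V
  occurs⇒substring []      p       = here p
  occurs⇒substring (_ ∷ α) (_ ∷ p) = there (occurs⇒substring α p)

  latestOccurrence : ∀ {σ} V → σ isSubstringOf V →
                     ∃ λ α → OccursAfter α σ V ×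
                             (∀ α′ → OccursAfter α′ σ V → length α′ ≤ length α)
  latestOccurrence [] (here p) = [] , p , λ { [] _ → z≤n }
  latestOccurrence {σ} (v ∷ V) i with infix? _≟_ σ V
  ... | yes j with latestOccurrence V j
  ...   | α , occ , max = v ∷ α , refl ∷ occ , λ where
            []       _       → z≤n
            (_ ∷ α′) (_ ∷ p) → s≤s (max α′ p)
  latestOccurrence (v ∷ V) (there i) | no ¬j = contradiction i ¬j
  latestOccurrence (v ∷ V) (here p)  | no ¬j = [] , p , λ where
    []       _       → z≤n
    (_ ∷ α′) (_ ∷ q) → contradiction (occurs⇒substring α′ q) ¬j

  followingDigit : ∀ {u V} l → u isPrefixOf V → ∃ λ y → (u ∷ʳ y) isPrefixOf (V ∷ʳ l)
  followingDigit {V = []}    l []         = l , refl ∷ []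
  followingDigit {V = v ∷ _} l []         = v , refl ∷ []
  followingDigit             l (refl ∷ p) with followingDigit l p
  ... | y , q = y , refl ∷ q

match : ∀ V l → ∃ (Match V l)
match V l
  with σ , suf , sub , max ← longestSuffix (λ s → infix? _≟_ s V) (here []) (V ∷ʳ l)
  with α , occ , lat ← latestOccurrence V sub
  with y , fol ← followingDigit l occ
  = y , record
      { σ = σ ; α = α ; suffix = suf ; substring = sub ; longest = max
      ; occurs = occ ; latest = lat ; follows = fol }

next : ∀ W → ∃ (Next W)
next W with initLast W
... | []      = false , start
... | V ∷ʳ′ l with match V l
...   | y , m = not y , step m

nextDigit : Str → Digit
nextDigit W = proj₁ (next W)

-- extend Z k = Z x₁ ⋯ x_k
extend : Str → ℕ → Str
extend Z zero    = Z
extend Z (suc k) = extend Z k ∷ʳ nextDigit (extend Z k)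

-- Indexed from 0: EM Z k is x_{k+1}.
EM : Str → ℕ → Digit
EM Z k = nextDigit (extend Z k)

-- 0100110101
_ : applyUpTo (EM []) 10 ≡
    false ∷ true ∷ false ∷ false ∷ true ∷ true ∷ false ∷ true ∷ false ∷ true ∷ []
_ = refl

{-# OPTIONS --safe #-}
module Submission where

-- Suppose X = EM(Z₁) = EM(Z₂) with Z₁ ≠ Z₂, let S be the longest common suffix
-- of the seeds and P = SX. Say that Z₁ = CaS while a does not precede S in Z₂.
-- A long initial segment of P has no short period, so for large L no word of
-- length L starts before P in both Z₁X and Z₂X, and the first two occurrences
-- of such a word in P are followed by different digits. In the
-- de Bruijn graph of the words of length L, the first vertex that P visits
-- three times is therefore its starting vertex P_L, and its two returns come
-- from different digits d and e.
--
-- If e = a, the second return to P_L is matched in Z₁X with the occurrence at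
-- the start of P, but in Z₂X with the first return. These two are followed by
-- different digits, so the next digits of the two sequences differ.
-- If e ≠ a, the second return is matched in Z₁X with the first one, hence is
-- the first return to P_{L+1}, and the second return to P_{L+1} comes from a.

open import Defs
open import Data.Bool.Base using (not)
open import Data.Bool.Properties using (not-¬; ¬-not; _≟_)
open import Data.Empty using (⊥; ⊥-elim)
open import Data.Fin.Base as Fin using (Fin; toℕ; fromℕ<; funToFin; finToFun)
open import Data.Fin.Properties using (2↔Bool; pigeonhole; toℕ-fromℕ<; toℕ<n; finToFun-funToFin)
open import Data.List.Base using ([]; _∷_; _++_; _∷ʳ_; length; reverse; _ʳ++_)
open import Data.List.Properties
  using (++-assoc; ∷-injectiveˡ; ∷-injectiveʳ; ∷ʳ-injective; length-++; ʳ++-defn; reverse-involutive)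
open import Data.List.Relation.Binary.Infix.Heterogeneous using (here; _++ⁱ_)
open import Data.List.Relation.Binary.Pointwise as Pointwise using (Pointwise-≡⇒≡)
open import Data.List.Relation.Binary.Prefix.Heterogeneous using ([]; _∷_)
open import Data.List.Relation.Binary.Suffix.Heterogeneous using (here; there; _++ˢ_)
open import Data.Nat.Base using (ℕ; zero; suc; _+_; _*_; _^_; _≤_; _<_; z≤n; s≤s; z<s; s<s)
open import Data.Nat.Induction using (<-rec)
open import Data.Nat.Properties hiding (_≟_)
open import Algebra.Properties.CommutativeSemigroup +-commutativeSemigroup using (xy∙z≈xz∙y; x∙yz≈xz∙y)
open import Data.Product.Base using (∃; ∃-syntax; _×_; _,_; proj₁; proj₂)
open import Data.Sum.Base using (_⊎_; inj₁; inj₂)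
open import Function.Bundles using (Inverse; Injection)
open import Function.Properties.Inverse using (↔-sym; ↔⇒↣)
open import Relation.Binary.Definitions using (tri<; tri≈; tri>)
open import Relation.Binary.PropositionalEquality
  using (_≡_; _≢_; _≗_; refl; sym; ≢-sym; trans; cong; cong₂; subst; subst₂; module ≡-Reasoning)
open import Relation.Nullary using (¬_; Dec; yes; no; contradiction)
open import Relation.Nullary.Decidable using (_×-dec_)

-- Infinite words and the generating rule in terms of positions.

Word : Set
Word = ℕ → Digit

Same : Word → ℕ → ℕ → ℕ → Set
Same w ℓ s t = ∀ {i} → i < ℓ → w (s + i) ≡ w (t + i)

-- The rule producing the digit at T: the suffix σ of length ℓ starts at t and
-- its chosen earlier occurrence at s.
record Rule (w : Word) (T : ℕ) : Set where
  field
    s t ℓ   : ℕ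
    s<t     : s < t
    ends    : t + ℓ ≡ T
    same    : Same w ℓ s t
    differ  : w (s + ℓ) ≢ w (t + ℓ)
    longest : ∀ {s′ t′ ℓ′} → s′ < t′ → t′ + ℓ′ ≡ T → Same w ℓ′ s′ t′ → ℓ′ ≤ ℓ
    latest  : ∀ {s′} → s′ < t → Same w ℓ s′ t → s′ ≤ s

-- From strings to positions: slices of an infinite word.

slice : Word → ℕ → ℕ → Str
slice w s zero    = []
slice w s (suc n) = w s ∷ slice w (suc s) n

length-slice : ∀ w s n → length (slice w s n) ≡ n
length-slice w s zero    = refl
length-slice w s (suc n) = cong suc (length-slice w (suc s) n)

slice-++ : ∀ w s m n → slice w s (m + n) ≡ slice w s m ++ slice w (s + m) n
slice-++ w s zero    n = cong (λ k → slice w k n) (sym (+-identityʳ s))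
slice-++ w s (suc m) n = cong (w s ∷_) (trans (slice-++ w (suc s) m n)
  (cong (λ k → slice w (suc s) m ++ slice w k n) (sym (+-suc s m))))

slice-∷ʳ : ∀ w s n → slice w s (suc n) ≡ slice w s n ∷ʳ w (s + n)
slice-∷ʳ w s n = trans (cong (slice w s) (+-comm 1 n)) (slice-++ w s n 1)

slice-cong : ∀ w n {s t} → Same w n s t → slice w s n ≡ slice w t n
slice-cong w zero    eq = refl
slice-cong w (suc n) {s} {t} eq = cong₂ _∷_
  (subst₂ (λ a b → w a ≡ w b) (+-identityʳ s) (+-identityʳ t) (eq z<s))
  (slice-cong w n λ {i} i<n → subst₂ (λ a b → w a ≡ w b) (+-suc s i) (+-suc t i) (eq (s<s i<n)))

slice-injective : ∀ w n {s t} → slice w s n ≡ slice w t n → Same w n s t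
slice-injective w (suc n) {s} {t} eq {zero} i<n =
  subst₂ (λ a b → w a ≡ w b) (sym (+-identityʳ s)) (sym (+-identityʳ t)) (∷-injectiveˡ eq)
slice-injective w (suc n) {s} {t} eq {suc i} (s<s i<n) =
  subst₂ (λ a b → w a ≡ w b) (sym (+-suc s i)) (sym (+-suc t i))
    (slice-injective w n (∷-injectiveʳ eq) i<n)

prefix-slice⁻ : ∀ w s n α {σ} → (α ++ σ) isPrefixOf slice w s n →
                σ ≡ slice w (s + length α) (length σ) × length α + length σ ≤ n
prefix-slice⁻ w s n [] {[]} [] = refl , z≤n
prefix-slice⁻ w s (suc n) [] {a ∷ σ} (refl ∷ p) with eq , le ← prefix-slice⁻ w (suc s) n [] p =
  cong₂ _∷_ (cong w (sym (+-identityʳ s))) eq , s≤s le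
prefix-slice⁻ w s (suc n) (a ∷ α) {σ} (_ ∷ p) with eq , le ← prefix-slice⁻ w (suc s) n α p =
  trans eq (cong (λ k → slice w k (length σ)) (sym (+-suc s (length α)))) , s≤s le

prefix-slice⁺ : ∀ w s {m n} → m ≤ n → slice w s m isPrefixOf slice w s n
prefix-slice⁺ w s z≤n     = []
prefix-slice⁺ w s (s≤s p) = refl ∷ prefix-slice⁺ w (suc s) p

suffix-slice⁻ : ∀ w s n {σ} → σ isSuffixOf slice w s n →
                ∃[ t ] t + length σ ≡ s + n × σ ≡ slice w t (length σ)
suffix-slice⁻ w s (suc n) (there p) with t , e , eq ← suffix-slice⁻ w (suc s) n p =
  t , trans e (sym (+-suc s n)) , eq
suffix-slice⁻ w s n (here p) with refl ← Pointwise-≡⇒≡ p =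
  s , cong (s +_) (length-slice w s n) , cong (slice w s) (sym (length-slice w s n))

suffix-slice⁺ : ∀ w m n → slice w m n isSuffixOf slice w 0 (m + n)
suffix-slice⁺ w m n = subst (slice w m n isSuffixOf_) (sym (slice-++ w 0 m n))
  (slice w 0 m ++ˢ here (Pointwise.refl refl))

substring-slice : ∀ w s ℓ {n} → s + ℓ ≤ n → slice w s ℓ isSubstringOf slice w 0 n
substring-slice w s ℓ le with r , refl ← m≤n⇒∃[o]m+o≡n le =
  subst (slice w s ℓ isSubstringOf_)
    (trans (sym (slice-++ w 0 s (ℓ + r))) (cong (slice w 0) (sym (+-assoc s ℓ r))))
    (slice w 0 s ++ⁱ here (prefix-slice⁺ w s (m≤m+n ℓ r)))

-- A position is the length of the string preceding it, so `α` and `σ` turn into slices. `differ`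
-- holds because `y` follows the earlier occurrence while the new digit is `not y`.
match⇒rule : ∀ w T {y} → Match (slice w 0 T) (w T) y → not y ≡ w (suc T) → Rule w (suc T)
match⇒rule w T {y} m y′ with suffix-slice⁻ w 0 (suc T) suffix′ | prefix-slice⁻ w 0 T α occurs
  where
  open Match m
  suffix′ : σ isSuffixOf slice w 0 (suc T)
  suffix′ = subst (σ isSuffixOf_) (sym (slice-∷ʳ w 0 T)) suffix
... | t , t+ℓ≡ , σ≡t | σ≡s , s+ℓ≤T = record
  { s = length α ; t = t ; ℓ = length σ
  ; s<t = +-cancelʳ-< (length σ) _ _ (subst (length α + length σ <_) (sym t+ℓ≡) (s≤s s+ℓ≤T))
  ; ends = t+ℓ≡
  ; same = slice-injective w _ (trans (sym σ≡s) σ≡t)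
  ; differ = λ eq → not-¬ refl (trans (trans y≡ eq) (trans (cong w t+ℓ≡) (sym y′)))
  ; longest = longest′
  ; latest = λ {s′} s′<t same′ → subst (_≤ length α) (length-slice w 0 s′)
      (latest (slice w 0 s′) (subst (_isPrefixOf slice w 0 T) (α′++σ s′ same′)
        (prefix-slice⁺ w 0 (≤-pred (subst (s′ + length σ <_) t+ℓ≡ (+-monoˡ-< (length σ) s′<t))))))
  }
  where
  open Match m
  y≡ : y ≡ w (length α + length σ)
  y≡ = trans (∷-injectiveˡ (proj₁ (prefix-slice⁻ w 0 (suc T) (α ++ σ)
         (subst (((α ++ σ) ∷ʳ y) isPrefixOf_) (sym (slice-∷ʳ w 0 T)) follows))))
       (cong w (length-++ α))
  α′++σ : ∀ s′ → Same w (length σ) s′ t → slice w 0 (s′ + length σ) ≡ slice w 0 s′ ++ σ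
  α′++σ s′ same′ = trans (slice-++ w 0 s′ (length σ))
    (cong (slice w 0 s′ ++_) (trans (slice-cong w _ same′) (sym σ≡t)))
  longest′ : ∀ {s′ t′ ℓ′} → s′ < t′ → t′ + ℓ′ ≡ suc T → Same w ℓ′ s′ t′ → ℓ′ ≤ length σ
  longest′ {s′} {t′} {ℓ′} s′<t′ ends′ same′ = subst (_≤ length σ) (length-slice w t′ ℓ′)
    (longest (slice w t′ ℓ′)
      (subst (slice w t′ ℓ′ isSuffixOf_) (trans (cong (slice w 0) ends′) (slice-∷ʳ w 0 T))
        (suffix-slice⁺ w t′ ℓ′))
      (subst (_isSubstringOf slice w 0 T) (slice-cong w ℓ′ same′)
        (substring-slice w s′ ℓ′ (≤-pred (subst (s′ + ℓ′ <_) ends′ (+-monoˡ-< ℓ′ s′<t′))))))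

-- The string is a variable `U` equated with the slice, so that matching on `Next` can unify its
-- index. A slice of positive length excludes `start`.
next⇒rule : ∀ w T {U y} → Next U y → U ≡ slice w 0 (suc T) → y ≡ w (suc T) → Rule w (suc T)
next⇒rule w T (step {V} {l} m) eq y≡
  with refl , refl ← ∷ʳ-injective V (slice w 0 T) (trans eq (slice-∷ʳ w 0 T)) = match⇒rule w T m y≡

-- A seed followed by its sequence.

infixr 5 _⊹_

_⊹_ : Str → Word → Word
([] ⊹ x) i            = x i
((z ∷ Z) ⊹ x) zero    = z
((z ∷ Z) ⊹ x) (suc i) = (Z ⊹ x) i

⊹-++ : ∀ C Z x → (C ++ Z) ⊹ x ≗ C ⊹ (Z ⊹ x)
⊹-++ []      Z x i       = refl
⊹-++ (c ∷ C) Z x zero    = refl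
⊹-++ (c ∷ C) Z x (suc i) = ⊹-++ C Z x i

⊹-cong : ∀ Z {x y} → x ≗ y → Z ⊹ x ≗ Z ⊹ y
⊹-cong []      e i       = e i
⊹-cong (z ∷ Z) e zero    = refl
⊹-cong (z ∷ Z) e (suc i) = ⊹-cong Z e i

⊹-skip : ∀ Z x i → (Z ⊹ x) (length Z + i) ≡ x i
⊹-skip []      x i = refl
⊹-skip (z ∷ Z) x i = ⊹-skip Z x i

slice-⊹ : ∀ Z x → slice (Z ⊹ x) 0 (length Z) ≡ Z
slice-⊹ []      x = refl
slice-⊹ (z ∷ Z) x = cong (z ∷_) (trans (shift (length Z) 0) (slice-⊹ Z x))
  where
  shift : ∀ n s → slice ((z ∷ Z) ⊹ x) (suc s) n ≡ slice (Z ⊹ x) s n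
  shift zero    s = refl
  shift (suc n) s = cong ((Z ⊹ x) s ∷_) (shift n (suc s))

extend≡slice : ∀ Z k → extend Z k ≡ slice (Z ⊹ EM Z) 0 (length Z + k)
extend≡slice Z zero    = trans (sym (slice-⊹ Z _)) (cong (slice _ 0) (sym (+-identityʳ _)))
extend≡slice Z (suc k) = begin
  extend Z k ∷ʳ EM Z k                                ≡⟨ cong₂ _∷ʳ_ (extend≡slice Z k) (sym (⊹-skip Z _ k)) ⟩
  slice w 0 (length Z + k) ∷ʳ w (length Z + k)        ≡⟨ slice-∷ʳ w 0 _ ⟨
  slice w 0 (suc (length Z + k))                      ≡⟨ cong (slice w 0) (+-suc (length Z) k) ⟨
  slice w 0 (length Z + suc k)                        ∎
  where
  open ≡-Reasoning
  w = Z ⊹ EM Z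

EM-rule : ∀ Z k → 0 < length Z + k → Rule (Z ⊹ EM Z) (length Z + k)
EM-rule Z k 0< = go (length Z + k) refl 0<
  where
  go : ∀ T → length Z + k ≡ T → 0 < T → Rule (Z ⊹ EM Z) T
  go (suc T) eq _ = next⇒rule (Z ⊹ EM Z) T (proj₂ (next (extend Z k)))
    (trans (extend≡slice Z k) (cong (slice _ 0) eq))
    (trans (sym (⊹-skip Z _ k)) (cong (Z ⊹ EM Z) eq))

-- The sequences of the two seeds agree only pointwise, so rules are carried along `≗`.
rule-cong : ∀ {w w′ T} → w ≗ w′ → Rule w T → Rule w′ T
rule-cong {w} {w′} e r = record
  { s = s ; t = t ; ℓ = ℓ ; s<t = s<t ; ends = ends
  ; same = λ i<ℓ → trans (sym (e _)) (trans (same i<ℓ) (e _))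
  ; differ = λ eq → differ (trans (e _) (trans eq (sym (e _))))
  ; longest = λ s′<t′ ends′ same′ → longest s′<t′ ends′ (back same′)
  ; latest = λ s′<t same′ → latest s′<t (back same′)
  }
  where
  open Rule r
  back : ∀ {ℓ s t} → Same w′ ℓ s t → Same w ℓ s t
  back same′ i<ℓ = trans (e _) (trans (same′ i<ℓ) (sym (e _)))

-- Shrinking and extending agreements.

same-drop : ∀ w c {ℓ s t} → Same w (c + ℓ) s t → Same w ℓ (s + c) (t + c)
same-drop w c {ℓ} {s} {t} e {i} i<ℓ =
  subst₂ (λ a b → w a ≡ w b) (sym (+-assoc s c i)) (sym (+-assoc t c i)) (e (+-monoʳ-< c i<ℓ))

same-tail : ∀ w {ℓ s t} → Same w (suc ℓ) s t → Same w ℓ (suc s) (suc t)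
same-tail w {s = s} {t} e {i} i<ℓ = subst₂ (λ a b → w a ≡ w b) (+-suc s i) (+-suc t i) (e (s<s i<ℓ))

same-head : ∀ w {ℓ s t} → Same w (suc ℓ) s t → w s ≡ w t
same-head w {s = s} {t} e = subst₂ (λ a b → w a ≡ w b) (+-identityʳ s) (+-identityʳ t) (e z<s)

same-init : ∀ {w ℓ s t} → Same w (suc ℓ) s t → Same w ℓ s t
same-init e i<ℓ = e (m<n⇒m<1+n i<ℓ)

same-cons : ∀ w {ℓ s t} → w s ≡ w t → Same w ℓ (suc s) (suc t) → Same w (suc ℓ) s t
same-cons w {s = s} {t} h e {zero}  _ = subst₂ (λ a b → w a ≡ w b) (sym (+-identityʳ s)) (sym (+-identityʳ t)) h
same-cons w {s = s} {t} h e {suc i} (s<s i<ℓ) = subst₂ (λ a b → w a ≡ w b) (sym (+-suc s i)) (sym (+-suc t i)) (e i<ℓ)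

same-snoc : ∀ {w ℓ s t} → Same w ℓ s t → w (s + ℓ) ≡ w (t + ℓ) → Same w (suc ℓ) s t
same-snoc e l i<1+ℓ with m<1+n⇒m<n∨m≡n i<1+ℓ
... | inj₁ i<ℓ  = e i<ℓ
... | inj₂ refl = l

same? : ∀ w ℓ s t → Dec (Same w ℓ s t)
same? w ℓ s t = allUpTo? (λ i → w (s + i) ≟ w (t + i)) ℓ

m≤n⇒∃o+m : ∀ {m n} → m ≤ n → ∃[ o ] o + m ≡ n
m≤n⇒∃o+m {m} m≤n with o , eq ← m≤n⇒∃[o]m+o≡n m≤n = o , trans (+-comm o m) eq

m<n⇒∃m+1+o : ∀ {m n} → m < n → ∃[ o ] m + suc o ≡ n
m<n⇒∃m+1+o {m} m<n with o , eq ← m≤n⇒∃[o]m+o≡n m<n = o , trans (+-suc m o) eq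

-- What the rule says about a recurring word of length `L`.

module _ {w : Word} {L : ℕ} where

  -- The match has length at least `L`, and the last `L` digits of its chosen earlier occurrence
  -- form an occurrence of the word followed by the opposite digit.
  recurrence-differs : ∀ {p q} → Rule w (q + L) → p < q → Same w L p q →
                       ∃[ r ] r < q × Same w L r q × w (r + L) ≢ w (q + L)
  recurrence-differs {p} {q} rule p<q same-pq
    with Rule.longest rule p<q refl same-pq
  ... | L≤ℓ with c , c+L≡ℓ ← m≤n⇒∃o+m L≤ℓ =
    s + c , subst (s + c <_) t+c≡q (+-monoˡ-< c s<t) ,
    subst (Same w L (s + c)) t+c≡q (same-drop w c (subst (λ k → Same w k s t) (sym c+L≡ℓ) same)) ,
    λ eq → differ (trans (cong w (sym (s+c+L≡ s))) (trans eq (cong w (sym ends))))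
    where
    open Rule rule
    s+c+L≡ : ∀ s → s + c + L ≡ s + ℓ
    s+c+L≡ s = trans (+-assoc s c L) (cong (s +_) c+L≡ℓ)
    t+c≡q : t + c ≡ q
    t+c≡q = +-cancelʳ-≡ L _ _ (trans (s+c+L≡ t) ends)

  latest-differs : ∀ {p q} → Rule w (suc q + L) → p < suc q → Same w L p (suc q) →
                   (∀ r → r < suc q → Same w L r (suc q) → r ≤ p) →
                   (∀ r → r < q → ¬ Same w (suc L) r q) →
                   w (p + L) ≢ w (suc q + L)
  latest-differs {p} {q} rule p<q same-pq last noLonger
    with Rule.longest rule p<q refl same-pq
  ... | L≤ℓ with m≤n⇒∃o+m L≤ℓ
  -- A match longer than `L` would contain an earlier occurrence of the word of length `suc L` at
  -- `q`. So its length is exactly `L`, and its source is the latest occurrence `p`.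
  ...   | suc c , refl = ⊥-elim (noLonger (s + c)
      (subst (s + c <_) t+c≡q (+-monoˡ-< c s<t))
      (subst (Same w (suc L) (s + c)) t+c≡q
        (same-drop w c (subst (λ k → Same w k s t) (sym (+-suc c L)) same))))
    where
    open Rule rule
    t+c≡q : t + c ≡ q
    t+c≡q = suc-injective (trans (sym (+-suc t c))
              (+-cancelʳ-≡ L _ _ (trans (+-assoc t (suc c) L) ends)))
  ...   | zero , refl
    with refl ← +-cancelʳ-≡ L (Rule.t rule) (suc q) (Rule.ends rule)
    with refl ← ≤-antisym (Rule.latest rule p<q same-pq) (last (Rule.s rule) (Rule.s<t rule) (Rule.same rule))
    = Rule.differ rule

-- Some word of length `L` occurs three times.

Thrice : Word → ℕ → ℕ → Set
Thrice P L k = ∃[ j ] j < k × ∃[ i ] i < j × Same P L i j × Same P L j k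

thrice? : ∀ P L k → Dec (Thrice P L k)
thrice? P L k = anyUpTo? (λ j → anyUpTo? (λ i → same? P L i j ×-dec same? P L j k) j) k

least : ∀ {Q : ℕ → Set} → (∀ n → Dec (Q n)) → ∀ n → Q n → ∃[ m ] Q m × (∀ k → k < m → ¬ Q k)
least {Q} Q? = <-rec _ go
  where
  go : ∀ n → (∀ {k} → k < n → Q k → ∃[ m ] Q m × (∀ k → k < m → ¬ Q k)) →
       Q n → ∃[ m ] Q m × (∀ k → k < m → ¬ Q k)
  go n rec q with anyUpTo? Q? n
  ... | yes (k , k<n , q′) = rec k<n q′
  ... | no ¬q              = n , q , λ k k<n q′ → ¬q (k , k<n , q′)

digitBit : Digit → Fin 2
digitBit = Inverse.from 2↔Bool

code : Word → (L : ℕ) → ℕ → Fin (2 ^ L)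
code w L s = funToFin {L} {2} (λ i → digitBit (w (s + toℕ i)))

code-injective : ∀ w L s t → code w L s ≡ code w L t → Same w L s t
code-injective w L s t eq {i} i<L = Injection.injective (↔⇒↣ (↔-sym 2↔Bool)) (begin
  digitBit (w (s + i))               ≡⟨ cong (λ j → digitBit (w (s + j))) (toℕ-fromℕ< i<L) ⟨
  digitBit (w (s + toℕ i′))          ≡⟨ finToFun-funToFin {L} (λ i → digitBit (w (s + toℕ i))) i′ ⟨
  finToFun {2} {L} (code w L s) i′   ≡⟨ cong (λ c → finToFun {2} {L} c i′) eq ⟩
  finToFun {2} {L} (code w L t) i′   ≡⟨ finToFun-funToFin {L} (λ i → digitBit (w (t + toℕ i))) i′ ⟩
  digitBit (w (t + toℕ i′))          ≡⟨ cong (λ j → digitBit (w (t + j))) (toℕ-fromℕ< i<L) ⟩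
  digitBit (w (t + i))               ∎)
  where
  open ≡-Reasoning
  i′ = fromℕ< i<L

-- Each of N + 1 consecutive windows of N + 1 positions, N = 2 ^ L, repeats some
-- word of length L; two windows repeat the same one.
thrice : ∀ w L → ∃ (Thrice w L)
thrice w L = go (pigeonhole (n<1+n N) (λ b → code w L (pos₁ b)))
  where
  N = 2 ^ L
  window : (b : Fin (suc N)) → ∃[ i ] ∃[ j ] i Fin.< j × code w L (toℕ b * suc N + toℕ i) ≡ code w L (toℕ b * suc N + toℕ j)
  window b = pigeonhole (n<1+n N) (λ i → code w L (toℕ b * suc N + toℕ i))
  pos₁ pos₂ : Fin (suc N) → ℕ
  pos₁ b = toℕ b * suc N + toℕ (proj₁ (window b))
  pos₂ b = toℕ b * suc N + toℕ (proj₁ (proj₂ (window b)))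
  pos₁<pos₂ : ∀ b → pos₁ b < pos₂ b
  pos₁<pos₂ b = +-monoʳ-< (toℕ b * suc N) (proj₁ (proj₂ (proj₂ (window b))))
  pos₂<pos₁ : ∀ {b b′} → b Fin.< b′ → pos₂ b < pos₁ b′
  pos₂<pos₁ {b} {b′} b<b′ = begin-strict
    toℕ b * suc N + toℕ (proj₁ (proj₂ (window b))) <⟨ +-monoʳ-< (toℕ b * suc N) (toℕ<n _) ⟩
    toℕ b * suc N + suc N                          ≡⟨ +-comm (toℕ b * suc N) (suc N) ⟩
    suc (toℕ b) * suc N                            ≤⟨ *-monoˡ-≤ (suc N) b<b′ ⟩
    toℕ b′ * suc N                                 ≤⟨ m≤m+n _ _ ⟩
    pos₁ b′                                        ∎
    where open ≤-Reasoning
  go : (∃[ b ] ∃[ b′ ] b Fin.< b′ × code w L (pos₁ b) ≡ code w L (pos₁ b′)) → ∃ (Thrice w L)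
  go (b , b′ , b<b′ , eq) = pos₁ b′ , pos₂ b , pos₂<pos₁ b<b′ , pos₁ b , pos₁<pos₂ b ,
    code-injective w L _ _ eq₁ , code-injective w L _ _ (trans (sym eq₁) eq)
    where
    eq₁ : code w L (pos₁ b) ≡ code w L (pos₂ b)
    eq₁ = proj₂ (proj₂ (proj₂ (window b)))

-- Words ending in `P`: early occurrences, first returns and aperiodicity.

-- An infinite word w that from position α on is P, and from position α + m + 1
-- on is generated by the rule.
record World (P : Word) (m : ℕ) : Set where
  field
    w    : Word
    α    : ℕ
    tail : ∀ i → w (α + i) ≡ P i
    rule : ∀ n → m < n → Rule w (α + n)

module _ {P : Word} {m : ℕ} (W : World P m) where
  open World W

  Preceded : Digit → Set
  Preceded e = ∃[ β ] α ≡ suc β × w β ≡ e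

  -- All earlier occurrences of the word then start inside `P`, the part common to both worlds.
  Fresh : ℕ → ℕ → Set
  Fresh L v = ∀ s → s < α → ¬ Same w L s (α + v)

  preceded-unique : ∀ {d e} → Preceded d → Preceded e → d ≡ e
  preceded-unique (b , eq , h) (b′ , eq′ , h′) =
    trans (sym h) (trans (cong w (suc-injective (trans (sym eq) eq′))) h′)

  tail₂ : ∀ p i → w (α + p + i) ≡ P (p + i)
  tail₂ p i = trans (cong w (+-assoc α p i)) (tail (p + i))

  lift : ∀ {L p q} → Same P L p q → Same w L (α + p) (α + q)
  lift {p = p} {q} e {i} i<L = trans (tail₂ p i) (trans (e i<L) (sym (tail₂ q i)))

  lower : ∀ {L p q} → Same w L (α + p) (α + q) → Same P L p q
  lower {p = p} {q} e {i} i<L = trans (sym (tail₂ p i)) (trans (e i<L) (tail₂ q i))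

  fresh-transfer : ∀ {L q} → Fresh L 0 → Same P L 0 q → Fresh L q
  fresh-transfer fresh e s s<α e′ =
    fresh s s<α (λ {i} i<L → trans (e′ i<L) (sym (lift e i<L)))

  -- By freshness and `only`, the occurrence supplied by `recurrence-differs` can only be `p`.
  first-return-differs : ∀ {L p q} → m < L → Fresh L q → p < q → Same P L p q →
                         (∀ r → r < q → Same P L r q → r ≡ p) → P (p + L) ≢ P (q + L)
  first-return-differs {L} {p} {q} m<L fresh p<q e only
    with recurrence-differs (subst (Rule w) (sym (+-assoc α q L)) (rule (q + L) (≤-trans m<L (m≤n+m L q))))
           (+-monoʳ-< α p<q) (lift e)
  ... | r , r<αq , e′ , differ with r <? α
  ...   | yes r<α = λ _ → fresh r r<α e′
  ...   | no r≮α with x , refl ← m≤n⇒∃[o]m+o≡n (≮⇒≥ r≮α)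
                 with refl ← only x (+-cancelˡ-< α x q r<αq) (lower e′)
    = λ eq → differ (trans (tail₂ x L) (trans eq (sym (tail₂ q L))))

  -- Under a period p the match for the digit at α + p + n has length ℓ ≥ n, so
  -- it reaches back by one more period: the digit following the matched
  -- occurrence equals the one p places earlier, which the match identifies with
  -- the digit p places before α + p + n, hence with the new digit itself.
  aperiodic : ∀ p n → 0 < p → m < n → α + p ≤ n → ¬ (∀ t → t ≤ n → P t ≡ P (p + t))
  aperiodic p n 0<p m<n αp≤n per = differ (begin
    w (s + ℓ)           ≡⟨ cong w s+ℓ≡ ⟩
    w (α + (p + y))     ≡⟨ tail (p + y) ⟩
    P (p + y)           ≡⟨ per y (subst (y ≤_) i+y≡n (m≤n+m y i)) ⟨
    P y                 ≡⟨ tail y ⟨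
    w (α + y)           ≡⟨ cong w s+z≡ ⟨
    w (s + z)           ≡⟨ same z<ℓ ⟩
    w (t + z)           ≡⟨ cong w t+z≡ ⟩
    w (α + n)           ≡⟨ tail n ⟩
    P n                 ≡⟨ per n ≤-refl ⟩
    P (p + n)           ≡⟨ tail (p + n) ⟨
    w (α + (p + n))     ≡⟨ cong w ends ⟨
    w (t + ℓ)           ∎)
    where
    open ≡-Reasoning
    open Rule (rule (p + n) (≤-trans m<n (m≤n+m n p)))
    n≤ℓ : n ≤ ℓ
    n≤ℓ = longest (m<m+n α 0<p) (+-assoc α p n)
            (λ {i} i<n → trans (tail i) (trans (per i (<⇒≤ i<n)) (sym (tail₂ p i))))
    t≤αp : t ≤ α + p
    t≤αp = +-cancelʳ-≤ n t (α + p) (≤-trans (+-monoʳ-≤ t n≤ℓ)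
             (≤-reflexive (trans ends (sym (+-assoc α p n)))))
    gap : ∃[ i ] s + i ≡ t
    gap = m≤n⇒∃[o]m+o≡n (<⇒≤ s<t)
    i = proj₁ gap
    s+i≡t = proj₂ gap
    -- The displacement `i` of the match is at most `t`, hence at most `α + p`; this is where
    -- `α + p ≤ n` enters.
    rest : ∃[ y ] i + y ≡ n
    rest = m≤n⇒∃[o]m+o≡n (≤-trans (subst (i ≤_) s+i≡t (m≤n+m i s)) (≤-trans t≤αp αp≤n))
    y = proj₁ rest
    i+y≡n = proj₂ rest
    over : ∃[ z ] t + z ≡ α + n
    over = m≤n⇒∃[o]m+o≡n (≤-trans t≤αp (+-monoʳ-≤ α (≤-trans (m≤n+m p α) αp≤n)))
    z = proj₁ over
    t+z≡ = proj₂ over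
    z<ℓ : z < ℓ
    z<ℓ = +-cancelˡ-< t z ℓ (subst₂ _<_ (sym t+z≡) (sym ends) (+-monoʳ-< α (m<n+m n 0<p)))
    s+ℓ≡ : s + ℓ ≡ α + (p + y)
    s+ℓ≡ = +-cancelʳ-≡ i _ _ (begin
      s + ℓ + i           ≡⟨ xy∙z≈xz∙y s ℓ i ⟩
      s + i + ℓ           ≡⟨ cong (_+ ℓ) s+i≡t ⟩
      t + ℓ               ≡⟨ ends ⟩
      α + (p + n)         ≡⟨ cong (λ n → α + (p + n)) i+y≡n ⟨
      α + (p + (i + y))   ≡⟨ trans (cong (α +_) (x∙yz≈xz∙y p i y)) (sym (+-assoc α (p + y) i)) ⟩
      α + (p + y) + i     ∎)
    s+z≡ : s + z ≡ α + y
    s+z≡ = +-cancelʳ-≡ i _ _ (begin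
      s + z + i           ≡⟨ xy∙z≈xz∙y s z i ⟩
      s + i + z           ≡⟨ cong (_+ z) s+i≡t ⟩
      t + z               ≡⟨ t+z≡ ⟩
      α + n               ≡⟨ cong (α +_) i+y≡n ⟨
      α + (i + y)         ≡⟨ x∙yz≈xz∙y α i y ⟩
      α + y + i           ∎)

  -- An occurrence starting `i` places before `P` runs on into `P`. Two different offsets `i` for
  -- the same `v` would thus give `P` a period.
  early-shift : ∀ {L s i v} → s + i ≡ α → Same w L s (α + v) → ∀ t → i + t < L → P t ≡ P (v + (i + t))
  early-shift {L} {s} {i} {v} eq e t lt = begin
    P t                 ≡⟨ tail t ⟨
    w (α + t)           ≡⟨ cong (λ a → w (a + t)) eq ⟨
    w (s + i + t)       ≡⟨ cong w (+-assoc s i t) ⟩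
    w (s + (i + t))     ≡⟨ e lt ⟩
    w (α + v + (i + t)) ≡⟨ tail₂ v (i + t) ⟩
    P (v + (i + t))     ∎
    where open ≡-Reasoning

  -- The digit at index `i` of such an occurrence is the one just before `P`.
  early-preceded : ∀ {L s i v} → s + suc i ≡ α → i < L → Same w L s (α + v) → Preceded (P (v + i))
  early-preceded {s = s} {i} {v} eq i<L e = s + i , trans (sym eq) (+-suc s i) , trans (e i<L) (tail₂ v i)

-- Digits following the first two returns.

-- The first two recurrences in P of its prefix of length L start at suc p and
-- suc q, and are preceded by different digits.
record Returns (P : Word) (L : ℕ) : Set where
  field
    p q    : ℕ
    p<q    : p < q
    same-p : Same P L 0 (suc p)
    same-q : Same P L 0 (suc q)
    only   : ∀ r → r < suc q → Same P L 0 r → r ≡ 0 ⊎ r ≡ suc p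
    turn   : P p ≢ P q

module _ {P : Word} {m L : ℕ} (m<L : m < L) (R : Returns P L) (W : World P m) (fresh : Fresh W L 0) where
  open Returns R
  open World W

  first-exit : P L ≢ P (suc p + L)
  first-exit = first-return-differs W m<L (fresh-transfer W fresh same-p) z<s same-p only₁
    where
    only₁ : ∀ r → r < suc p → Same P L r (suc p) → r ≡ 0
    only₁ r r<p e with only r (<-trans r<p (s<s p<q)) (λ {i} i<L → trans (same-p i<L) (sym (e i<L)))
    ... | inj₁ r≡0  = r≡0
    ... | inj₂ refl = contradiction r<p (<-irrefl refl)

  private
    shift : ∀ {r} → Same w (suc L) r (α + q) → Same w L (suc r) (α + suc q)
    shift {r} e = subst (Same w L (suc r)) (sym (+-suc α q)) (same-tail w e)

    only-second : ∀ {x} → x < suc q → Same w L (α + x) (α + suc q) → x ≡ 0 ⊎ x ≡ suc p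
    only-second x<q e = only _ x<q (λ {i} i<L → trans (same-q i<L) (sym (lower W e i<L)))

    -- Without its first digit the word is the prefix of `P` of length `L`. Freshness excludes a
    -- start before `P`, and `turn` excludes the first return; only the start of `P` is left.
    longer-initial : ∀ r → r < α + q → Same w (suc L) r (α + q) → suc r ≡ α
    longer-initial r r<αq e with <-cmp (suc r) α
    ... | tri< lt _ _ = ⊥-elim (fresh-transfer W fresh same-q (suc r) lt (shift e))
    ... | tri≈ _ eq _ = eq
    ... | tri> _ _ (s≤s α≤r) with x , refl ← m≤n⇒∃[o]m+o≡n α≤r
      with only-second (s<s (+-cancelˡ-< α x q r<αq)) (subst (λ k → Same w L k (α + suc q)) (sym (+-suc α x)) (shift e))
    ...   | inj₂ refl = ⊥-elim (turn (trans (sym (tail p)) (trans (same-head w e) (tail q))))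

  -- The word of length `suc L` at `q` also occurs one place before `P`, and by `longer-initial`
  -- nowhere else earlier.
  second-exit-preceded : Preceded W (P q) → P L ≢ P (suc q + L)
  second-exit-preceded (β , α≡ , wβ)
    with recurrence-differs {L = suc L} {β} {α + q} (subst (Rule w) ends (rule (suc q + L) (≤-trans m<L (m≤n+m L (suc q)))))
           (subst (_≤ α + q) α≡ (m≤m+n α q))
           (same-cons w (trans wβ (sym (tail q))) (subst₂ (Same w L) (trans (+-identityʳ α) α≡) (+-suc α q) (lift W same-q)))
    where
    ends : α + (suc q + L) ≡ α + q + suc L
    ends = trans (cong (α +_) (sym (+-suc q L))) (sym (+-assoc α q (suc L)))
  ... | r , r<αq , e , differ = λ eq → differ (begin
    w (r + suc L)       ≡⟨ cong w (+-suc r L) ⟩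
    w (suc r + L)       ≡⟨ cong (λ k → w (k + L)) (longer-initial r r<αq e) ⟩
    w (α + L)           ≡⟨ tail L ⟩
    P L                 ≡⟨ eq ⟩
    P (suc q + L)       ≡⟨ cong P (+-suc q L) ⟨
    P (q + suc L)       ≡⟨ tail₂ W q (suc L) ⟨
    w (α + q + suc L)   ∎)
    where open ≡-Reasoning

  -- No longer match exists, since by `longer-initial` it would begin with the digit before `P`. The
  -- match therefore has length `L`, and its latest source is the first return.
  second-exit-unpreceded : ¬ Preceded W (P q) → P (suc p + L) ≢ P (suc q + L)
  second-exit-unpreceded ¬pre eq = latest-differs {L = L} {α + suc p} {α + q}
    (subst (Rule w) (trans (+-suc α (q + L)) (cong suc (sym (+-assoc α q L)))) (rule (suc q + L) (≤-trans m<L (m≤n+m L (suc q)))))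
    (subst (α + suc p <_) (+-suc α q) (+-monoʳ-< α (s<s p<q)))
    (subst (Same w L (α + suc p)) (+-suc α q) (lift W {L} {suc p} {suc q} (λ i<L → trans (sym (same-p i<L)) (same-q i<L))))
    last
    (λ r r<αq e → ¬pre (r , sym (longer-initial r r<αq e) , trans (same-head w e) (tail q)))
    (trans (tail₂ W (suc p) L) (trans eq (trans (sym (tail₂ W (suc q) L)) (cong (λ k → w (k + L)) (+-suc α q)))))
    where
    last : ∀ r → r < suc (α + q) → Same w L r (suc (α + q)) → r ≤ α + suc p
    last r r<αq e with r <? α
    ... | yes r<α = ≤-trans (<⇒≤ r<α) (m≤m+n α (suc p))
    ... | no r≮α with x , refl ← m≤n⇒∃[o]m+o≡n (≮⇒≥ r≮α)
      with only-second (+-cancelˡ-< α x (suc q) (subst (α + x <_) (sym (+-suc α q)) r<αq))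
             (subst (Same w L (α + x)) (sym (+-suc α q)) e)
    ...   | inj₁ refl = +-monoʳ-≤ α z≤n
    ...   | inj₂ refl = ≤-refl

-- Existence of the two returns.

≢-≢⇒≡ : ∀ {a b c : Digit} → a ≢ b → b ≢ c → a ≡ c
≢-≢⇒≡ a≢b b≢c = trans (¬-not a≢b) (sym (¬-not (≢-sym b≢c)))

-- The de Bruijn graph argument: since the first two exits from a word differ,
-- a word entered twice from the same vertex is not the first to occur a third
-- time; hence that word is the one where the path starts.
returns : ∀ {P m L} (A B : World P m) → m < L → (∀ v → Fresh A L v ⊎ Fresh B L v) → Returns P L
returns {P} {m} {L} A B m<L fresh = first-triple (least (thrice? P L) _ (proj₂ (thrice P L)))
  where
  first-triple : (∃[ k ] Thrice P L k × (∀ k′ → k′ < k → ¬ Thrice P L k′)) → Returns P L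
  first-triple (suc k , (suc j , j<k , i , i<j , eᵢ , eⱼ) , minimal) = start-or-third i i<j eᵢ
    where
    only-earlier : ∀ {u v} → u < v → v < suc k → Same P L u v → ∀ r → r < v → Same P L r v → r ≡ u
    only-earlier {u} {v} u<v v<k e r r<v e′ with <-cmp r u
    ... | tri< r<u _ _ = ⊥-elim (minimal v v<k (u , u<v , r , r<u , (λ i<L → trans (e′ i<L) (sym (e i<L))) , e))
    ... | tri≈ _ eq _  = eq
    ... | tri> _ _ u<r = ⊥-elim (minimal v v<k (r , r<v , u , u<r , (λ i<L → trans (e i<L) (sym (e′ i<L))) , e′))

    exits-differ : ∀ {u v} → u < v → v < suc k → Same P L u v → P (u + L) ≢ P (v + L)
    -- Freshness in either world will do, as the conclusion concerns `P` alone.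
    exits-differ {u} {v} u<v v<k e with fresh v
    ... | inj₁ f = first-return-differs A m<L f u<v e (only-earlier u<v v<k e)
    ... | inj₂ f = first-return-differs B m<L f u<v e (only-earlier u<v v<k e)

    -- Equal entering digits would extend both occurrences to the left, giving two visits to one
    -- vertex with the same exit.
    entries-differ : ∀ {u v} → u < v → v < suc k → Same P L (suc u) (suc v) → P u ≢ P v
    entries-differ {u} {v} u<v v<k e eq = exits-differ u<v v<k (same-init {P} long) (long ≤-refl)
      where
      long : Same P (suc L) u v
      long = same-cons P eq e

    start-or-third : ∀ i → i < suc j → Same P L i (suc j) → Returns P L
    -- Three entering digits cannot be pairwise different, so the first of the three visits has no
    -- entry: it is at position 0.
    start-or-third (suc i) (s≤s i<j) e = ⊥-elim (entries-differ (<-trans i<j (≤-pred j<k)) (n<1+n k)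
      (λ x<L → trans (e x<L) (eⱼ x<L))
      (≢-≢⇒≡ (entries-differ i<j (<-trans (≤-pred j<k) (n<1+n k)) e) (entries-differ (≤-pred j<k) (n<1+n k) eⱼ)))
    start-or-third zero _ e = record
      { p = j ; q = k ; p<q = ≤-pred j<k
      ; same-p = e
      ; same-q = λ x<L → trans (e x<L) (eⱼ x<L)
      ; only = only
      ; turn = entries-differ (≤-pred j<k) (n<1+n k) eⱼ
      }
      where
      only : ∀ r → r < suc k → Same P L 0 r → r ≡ 0 ⊎ r ≡ suc j
      only zero    _   _  = inj₁ refl
      only (suc r) r<k e′ with <-cmp r j
      ... | tri< r<j _ _ = ⊥-elim (0≢1+n (sym (only-earlier z<s j<k e (suc r) (s<s r<j) (λ x<L → trans (sym (e′ x<L)) (e x<L)))))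
      ... | tri≈ _ eq _  = inj₂ (cong suc eq)
      ... | tri> _ _ j<r = ⊥-elim (0≢1+n (sym (only-earlier z<s r<k e′ (suc j) (s<s j<r) (λ x<L → trans (sym (e x<L)) (e′ x<L)))))

-- Two worlds distinguished by the digit before `P` cannot coexist.

module Distinguished {P : Word} {m : ℕ} (A B : World P m) {a : Digit}
                     (pre-A : Preceded A a) (¬pre-B : ¬ Preceded B a) where
  open World A using () renaming (w to wA; α to αA)
  open World B using () renaming (w to wB; α to αB)

  -- `K` bounds the offset of every start before `P` in either world. `n` is large enough to apply
  -- `aperiodic` in `A` to all periods up to `K`, and a length above `K + n` leaves room for such a
  -- shift on all `t ≤ n`.
  K n : ℕ
  K = αA + αB
  n = suc m + (αA + K)

  m<length : ∀ {L} → K + n < L → m < L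
  m<length Kn<L = ≤-<-trans (≤-trans (≤-trans (n≤1+n m) (m≤m+n (suc m) (αA + K))) (m≤n+m n K)) Kn<L

  -- Comparing the two shifts gives `P` the period `j - i` as far as `n`.
  no-shared-shift : ∀ {L} → K + n < L → ∀ v {i j} → i < j → j ≤ K →
                    (∀ t → i + t < L → P t ≡ P (v + (i + t))) →
                    ¬ (∀ t → j + t < L → P t ≡ P (v + (j + t)))
  no-shared-shift {L} Kn<L v {i} {j} i<j j≤K shiftᵢ shiftⱼ
    with p , refl ← m≤n⇒∃[o]m+o≡n (<⇒≤ i<j)
    = aperiodic A p n (+-cancelˡ-< i 0 p (subst (_< i + p) (sym (+-identityʳ i)) i<j))
        (m≤m+n (suc m) (αA + K))
        (≤-trans (+-monoʳ-≤ αA (≤-trans (m≤n+m p i) j≤K)) (m≤n+m (αA + K) (suc m)))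
        λ t t≤n → trans (shiftⱼ t (lt t t≤n)) (trans
          (cong (λ k → P (v + k)) (+-assoc i p t))
          (sym (shiftᵢ (p + t) (subst (_< L) (+-assoc i p t) (lt t t≤n)))))
    where
    lt : ∀ t → t ≤ n → i + p + t < L
    lt t t≤n = ≤-<-trans (+-mono-≤ j≤K t≤n) Kn<L

  fresh-initial : (W : World P m) → World.α W ≤ K → ∀ {L} → K + n < L → Fresh W L 0
  fresh-initial W α≤K {L} Kn<L s s<α e with i , s+i≡α ← m≤n⇒∃[o]m+o≡n (<⇒≤ s<α) =
    no-shared-shift {L} Kn<L 0 {0} {i}
      (+-cancelˡ-< s 0 i (subst₂ _<_ (sym (+-identityʳ s)) (sym s+i≡α) s<α))
      (≤-trans (subst (i ≤_) s+i≡α (m≤n+m i s)) α≤K)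
      -- For `v = 0` the trivial agreement of `P` with itself is the shift of offset 0.
      (λ _ _ → refl) (early-shift W {L} s+i≡α e)

  -- Early starts in both worlds at different offsets would give a period; at equal offsets they
  -- would force the same digit before `P`.
  fresh-in-one : ∀ {L} → K + n < L → ∀ v → Fresh A L v ⊎ Fresh B L v
  fresh-in-one {L} Kn<L v
    with anyUpTo? (λ s → same? wA L s (αA + v)) αA | anyUpTo? (λ s → same? wB L s (αB + v)) αB
  ... | no ¬a | _     = inj₁ λ s s<α e → ¬a (s , s<α , e)
  ... | yes _ | no ¬b = inj₂ λ s s<α e → ¬b (s , s<α , e)
  ... | yes (s , s<α , e) | yes (s′ , s′<α , e′)
    with i , s+i≡α ← m<n⇒∃m+1+o s<α | j , s′+j≡α ← m<n⇒∃m+1+o s′<α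
    with i≤K ← ≤-trans (subst (suc i ≤_) s+i≡α (m≤n+m (suc i) s)) (m≤m+n αA αB)
       | j≤K ← ≤-trans (subst (suc j ≤_) s′+j≡α (m≤n+m (suc j) s′)) (m≤n+m αB αA)
    with <-cmp i j
  ... | tri< i<j _ _ = ⊥-elim (no-shared-shift {L} Kn<L v (s<s i<j) j≤K (early-shift A {L} s+i≡α e) (early-shift B {L} s′+j≡α e′))
  ... | tri> _ _ j<i = ⊥-elim (no-shared-shift {L} Kn<L v (s<s j<i) i≤K (early-shift B {L} s′+j≡α e′) (early-shift A {L} s+i≡α e))
  ... | tri≈ _ refl _ = ⊥-elim (¬pre-B (subst (Preceded B)
      (preceded-unique A (early-preceded A s+i≡α i<L e) pre-A) (early-preceded B s′+j≡α i<L e′)))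
    where
    i<L : i < L
    i<L = <-trans (≤-trans i≤K (m≤m+n K n)) Kn<L

  -- Otherwise the digits following the start, the first return and the second return would be
  -- pairwise different.
  not-preceded : ∀ {L} → K + n < L → (R : Returns P L) → P (Returns.q R) ≢ a
  not-preceded Kn<L R eq = first-exit m<L R A freshA (≢-≢⇒≡
    (second-exit-preceded m<L R A freshA (subst (Preceded A) (sym eq) pre-A))
    (≢-sym (second-exit-unpreceded m<L R B (fresh-initial B (m≤n+m αB αA) Kn<L)
      (λ pre → ¬pre-B (subst (Preceded B) eq pre)))))
    where
    m<L    = m<length Kn<L
    freshA = fresh-initial A (m≤m+n αA αB) Kn<L

  -- The second return for `L` becomes the first for `suc L`. It is not entered from `a`, so by
  -- `turn` the next one is, against `not-preceded`.
  consecutive-returns : ∀ {L} → K + n < L → Returns P L → ¬ Returns P (suc L)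
  consecutive-returns {L} Kn<L R R′ =
    not-preceded (m<n⇒m<1+n Kn<L) R′
      (sym (≢-≢⇒≡ (≢-sym (subst (λ k → P k ≢ a) (sym p′≡q) Pq≢a)) R′.turn))
    where
    module R = Returns R
    module R′ = Returns R′
    fresh = fresh-initial A (m≤m+n αA αB) Kn<L
    Pq≢a : P R.q ≢ a
    Pq≢a = not-preceded Kn<L R
    first≢ : P L ≢ P (suc R.p + L)
    first≢ = first-exit (m<length Kn<L) R A fresh
    second≢ : P (suc R.p + L) ≢ P (suc R.q + L)
    second≢ = second-exit-unpreceded (m<length Kn<L) R A fresh
      (λ pre → Pq≢a (preceded-unique A pre pre-A))
    same-q⁺ : Same P (suc L) 0 (suc R.q)
    same-q⁺ = same-snoc {P} {L} {0} {suc R.q} R.same-q (≢-≢⇒≡ first≢ second≢)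
    p′≡q : R′.p ≡ R.q
    p′≡q with <-cmp R′.p R.q
    ... | tri≈ _ eq _ = eq
    ... | tri> _ _ q<p′ with R′.only (suc R.q) (s<s (<-trans q<p′ R′.p<q)) same-q⁺
    ...   | inj₂ eq = contradiction q<p′ (<-irrefl (suc-injective eq))
    -- An earlier return of the longer prefix would be the first return of the shorter one, whose
    -- exit is wrong.
    p′≡q | tri< p′<q _ _ with R.only (suc R′.p) (s<s p′<q) (same-init {P} {L} {0} {suc R′.p} R′.same-p)
    ...   | inj₂ eq = contradiction (trans (R′.same-p (n<1+n L)) (cong (λ k → P (k + L)) eq)) first≢

  impossible : ⊥
  impossible = consecutive-returns (n<1+n (K + n)) (at (n<1+n (K + n))) (at (m<n⇒m<1+n (n<1+n (K + n))))
    where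
    at : ∀ {L} → K + n < L → Returns P L
    at Kn<L = returns A B (m<length Kn<L) (fresh-in-one Kn<L)

-- Comparing the seeds from their ends.

data Difference : Str → Str → Set where
  equal    : ∀ {S} → Difference S S
  longer   : ∀ {C a S} → Difference (C ++ a ∷ S) S
  shorter  : ∀ {D b S} → Difference S (D ++ b ∷ S)
  mismatch : ∀ {C a D b S} → a ≢ b → Difference (C ++ a ∷ S) (D ++ b ∷ S)

-- Reversal brings the last digits to the front; the common ones stripped off accumulate in `S`.
difference : ∀ Z₁ Z₂ → Difference Z₁ Z₂
difference Z₁ Z₂ = subst₂ Difference (reverse-involutive Z₁) (reverse-involutive Z₂) (go (reverse Z₁) (reverse Z₂) [])
  where
  go : ∀ U V S → Difference (U ʳ++ S) (V ʳ++ S)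
  go [] [] S = equal
  go (a ∷ U) [] S = subst (λ Z → Difference Z S) (sym (ʳ++-defn U)) longer
  go [] (b ∷ V) S = subst (Difference S) (sym (ʳ++-defn V)) shorter
  go (a ∷ U) (b ∷ V) S with a ≟ b
  ... | yes refl = go U V (a ∷ S)
  ... | no a≢b   = subst₂ Difference (sym (ʳ++-defn U)) (sym (ʳ++-defn V)) (mismatch a≢b)

-- Taking `X` up to `≗` lets both seeds yield worlds over one and the same `P`, namely `S ⊹ X`.
world : ∀ C S {X} → EM (C ++ S) ≗ X → World (S ⊹ X) (length S)
world C S {X} e = record
  { w = C ⊹ S ⊹ X
  ; α = length C
  ; tail = ⊹-skip C (S ⊹ X)
  ; rule = rule
  }
  where
  Z = C ++ S
  rule : ∀ n → length S < n → Rule (C ⊹ S ⊹ X) (length C + n)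
  -- The strict bound keeps the position positive, so the convention for an empty string never
  -- arises.
  rule n S<n with k , refl ← m≤n⇒∃[o]m+o≡n (<⇒≤ S<n) = rule-cong
    (λ i → trans (⊹-cong Z e i) (⊹-++ C S X i))
    (subst (Rule (Z ⊹ EM Z)) ends (EM-rule Z k (subst (0 <_) (sym ends)
      (≤-trans (≤-<-trans z≤n S<n) (m≤n+m (length S + k) (length C))))))
    where
    ends : length Z + k ≡ length C + (length S + k)
    ends = trans (cong (_+ k) (length-++ C)) (+-assoc (length C) (length S) k)

world-∷ : ∀ C a S {X} → EM (C ++ a ∷ S) ≗ X →
          ∃[ W ] Preceded {S ⊹ X} {length S} W a
world-∷ C a S {X} e = world (C ∷ʳ a) S (subst (λ Z → EM Z ≗ X) (sym (++-assoc C _ S)) e) ,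
  length C , trans (length-++ C) (+-comm (length C) 1) ,
  trans (cong (C ∷ʳ a ⊹ S ⊹ X) (sym (+-identityʳ (length C))))
    (trans (⊹-++ C (a ∷ []) (S ⊹ X) (length C + 0)) (⊹-skip C _ 0))

EM-++∷≢EM : ∀ C a S → ¬ EM (C ++ a ∷ S) ≗ EM S
EM-++∷≢EM C a S e with W , pre ← world-∷ C a S e =
  -- Here `P` starts at position 0 of the second world, so no digit precedes it.
  Distinguished.impossible W (world [] S (λ _ → refl)) pre λ ()

theorem3p3 : ∀ (Z₁ Z₂ : Str) → EM Z₁ ≗ EM Z₂ → Z₁ ≡ Z₂
theorem3p3 Z₁ Z₂ e with difference Z₁ Z₂
... | equal = refl
... | longer {C} {a} {S} = ⊥-elim (EM-++∷≢EM C a S e)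
... | shorter {D} {b} {S} = ⊥-elim (EM-++∷≢EM D b S (λ i → sym (e i)))
... | mismatch {C} {a} {D} {b} {S} a≢b
  with A , pre-A ← world-∷ C a S e | B , pre-B ← world-∷ D b S (λ _ → refl)
  = ⊥-elim (Distinguished.impossible A B pre-A λ pre → a≢b (preceded-unique B pre pre-B))
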